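{- Let $n\ge2$, let $\theta<\omega^\omega$ be a nonzero limit ordinal, and let $\alpha$ be a nonzero limit ordinal. Then $\mathfrak T_\alpha^n$ is elementarily equivalent to $\mathfrak T_\theta^n$ if and only if $\alpha=\theta$.
   Context: For a nonzero limit ordinal $\alpha$, $\mathfrak T_\alpha^n=(n^{<\alpha},\subseteq,S_0,\dots,S_{n-1})$, where $n^{<\alpha}$ is the set of all functions $s:\beta\to n=\{0,\dots,n-1\}$ with $\beta<\alpha$, $\subseteq$ is the initial-segment (inclusion) order, and $S_i(s)$ is $s$ extended by one further entry $i$. -}

module Defs where

open import Data.Empty.Polymorphic using (⊥)
open import Data.Fin using (Fin)
open import Data.Nat as ℕ using (ℕ; zero; suc)
import Data.Nat.Induction as ℕ
import Data.Nat.Properties as ℕ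
open import Data.Product using (Σ; ∃; _×_; _,_; proj₁; proj₂)
open import Data.Product.Relation.Binary.Lex.Strict
  using (×-Lex; ×-isStrictTotalOrder; ×-wellFounded)
open import Data.Product.Relation.Binary.Pointwise.NonDependent using (≡×≡⇒≡; ≡⇒≡×≡)
open import Data.Sum using (_⊎_; inj₁; inj₂)
open import Data.Unit using (⊤; tt)
open import Data.Vec using (Vec; []; _∷_; lookup)
open import Function using (_∘_)
open import Function.Bundles using (_⇔_)
open import Induction.WellFounded using (WellFounded; acc)
open import Level using (Level; 0ℓ; _⊔_) renaming (suc to lsuc)
open import Relation.Binary
  using (Rel; IsStrictTotalOrder; IsEquivalence; _Respects₂_; Tri; tri<; tri≈; tri>)
open import Relation.Binary.Morphism.Structures using (IsOrderMonomorphism; IsOrderIsomorphism)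
open import Relation.Binary.PropositionalEquality
  using (_≡_; refl; sym; trans; isEquivalence)
open import Relation.Binary.Structures.Biased using (isStrictTotalOrderᶜ)
open import Relation.Nullary using (yes; no; contradiction)

private
  variable
    a b ℓ : Level

-- An ordinal is represented by a well-ordered type.  An element β of α
-- stands for an ordinal β < α, namely for the order type of {γ ∣ γ < β};
-- equality of ordinals is order isomorphism.

record Ordinal (ℓ : Level) : Set (lsuc ℓ) where
  infix 4 _<_
  field
    Carrier            : Set ℓ
    _<_                : Rel Carrier ℓ
    isStrictTotalOrder : IsStrictTotalOrder _≡_ _<_
    wellFounded        : WellFounded _<_

  open IsStrictTotalOrder isStrictTotalOrder public
    using (compare; _<?_; irrefl) renaming (trans to <-trans)

infix 4 _≅_ _<ₒ_ _<ω^ω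

_≅_ : Ordinal a → Ordinal b → Set (a ⊔ b)
α ≅ β = ∃ (IsOrderIsomorphism _≡_ _≡_ (_<_ α) (_<_ β))
  where open Ordinal

-- α < β: α is isomorphic to a proper initial segment {y ∣ y < c} of β.
_<ₒ_ : Ordinal a → Ordinal b → Set (a ⊔ b)
α <ₒ β = Σ (A.Carrier → B.Carrier) λ f →
         IsOrderMonomorphism _≡_ _≡_ A._<_ B._<_ f ×
         Σ B.Carrier λ c → ∀ y → (y B.< c) ⇔ (Σ A.Carrier λ x → f x ≡ y)
  where
  module A = Ordinal α
  module B = Ordinal β

𝟙 : Ordinal 0ℓ
𝟙 = record
  { Carrier            = ⊤
  ; _<_                = λ _ _ → ⊥
  ; isStrictTotalOrder = isStrictTotalOrderᶜ record
    { isEquivalence = isEquivalence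
    ; trans         = λ ()
    ; compare       = λ _ _ → tri≈ (λ ()) refl (λ ())
    }
  ; wellFounded        = λ _ → acc λ ()
  }

ω : Ordinal 0ℓ
ω = record
  { Carrier            = ℕ
  ; _<_                = ℕ._<_
  ; isStrictTotalOrder = ℕ.<-isStrictTotalOrder
  ; wellFounded        = ℕ.<-wellFounded
  }

-- α · β is "β copies of α": the component in β is the more significant
-- one and is therefore put first.
infixl 7 _·_

_·_ : Ordinal ℓ → Ordinal ℓ → Ordinal ℓ
α · β = record
  { Carrier            = B.Carrier × A.Carrier
  ; _<_                = ×-Lex _≡_ B._<_ A._<_
  ; isStrictTotalOrder = isStrictTotalOrderᶜ record
    { isEquivalence = isEquivalence
    ; trans         = λ {x} {y} {z} → Lex.trans {x} {y} {z}
    ; compare       = λ x y → fromPointwise (Lex.compare x y)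
    }
  ; wellFounded        = ×-wellFounded B.wellFounded A.wellFounded
  }
  where
  module A = Ordinal α
  module B = Ordinal β
  module Lex = IsStrictTotalOrder
    (×-isStrictTotalOrder B.isStrictTotalOrder A.isStrictTotalOrder)

  fromPointwise : ∀ {x y : B.Carrier × A.Carrier} {P Q : Set _} →
                  Tri P (proj₁ x ≡ proj₁ y × proj₂ x ≡ proj₂ y) Q → Tri P (x ≡ y) Q
  fromPointwise (tri< p ¬e ¬q) = tri< p (¬e ∘ ≡⇒≡×≡) ¬q
  fromPointwise (tri≈ ¬p e ¬q) = tri≈ ¬p (≡×≡⇒≡ e) ¬q
  fromPointwise (tri> ¬p ¬e q) = tri> ¬p (¬e ∘ ≡⇒≡×≡) q

infixr 8 ω^_

ω^_ : ℕ → Ordinal 0ℓ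
ω^ zero  = 𝟙
ω^ suc k = ω^ k · ω

-- ω^ω is by definition the supremum (union) of the ω^k with k < ω, so
-- being below it means being below some ω^k.
_<ω^ω : Ordinal ℓ → Set ℓ
α <ω^ω = ∃ λ k → α <ₒ ω^ k

-- α is a nonzero limit: 0 < α, and β < α implies β + 1 < α, where
-- β + 1 = β ∪ {β}.
record IsNonzeroLimit (α : Ordinal ℓ) : Set ℓ where
  open Ordinal α
  field
    nonzero    : Carrier
    successors : ∀ β → Σ Carrier λ β⁺ → ∀ γ → (γ < β⁺) ⇔ (γ < β ⊎ γ ≡ β)

  infix 9 _⁺
  _⁺ : Carrier → Carrier
  β ⁺ = proj₁ (successors β)

  <⁺ : ∀ β {γ} → (γ < β ⁺) ⇔ (γ < β ⊎ γ ≡ β)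
  <⁺ β = proj₂ (successors β) _

-- A structure for {⊆, S₀, …, Sₙ₋₁}; the symbol = is interpreted by _≈_.
record Structure (n : ℕ) (ℓ : Level) : Set (lsuc ℓ) where
  infix 4 _≈_ _⊑_
  field
    Carrier       : Set ℓ
    _≈_           : Rel Carrier ℓ
    _⊑_           : Rel Carrier ℓ
    S             : Fin n → Carrier → Carrier
    ≈-equivalence : IsEquivalence _≈_
    ⊑-resp-≈      : _⊑_ Respects₂ _≈_
    S-cong        : ∀ i {s t} → s ≈ t → S i s ≈ S i t

-- k is the number of free de Bruijn variables.

data Term (n k : ℕ) : Set where
  var : Fin k → Term n k
  S   : Fin n → Term n k → Term n k

infix  8 _≐_ _⊑_
infixr 7 _∧_
infixr 6 _∨_
infixr 5 _⇒_

data Formula (n k : ℕ) : Set where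
  _≐_ _⊑_     : Term n k → Term n k → Formula n k
  ⊥̇           : Formula n k
  _∧_ _∨_ _⇒_ : Formula n k → Formula n k → Formula n k
  ∀̇ ∃̇         : Formula n (suc k) → Formula n k

Sentence : ℕ → Set
Sentence n = Formula n 0

module _ {n : ℕ} (M : Structure n ℓ) where
  private module M = Structure M

  ⟦_⟧ : ∀ {k} → Term n k → Vec M.Carrier k → M.Carrier
  ⟦ var x ⟧ ρ = lookup ρ x
  ⟦ S i t ⟧ ρ = M.S i (⟦ t ⟧ ρ)

  Sat : ∀ {k} → Formula n k → Vec M.Carrier k → Set ℓ
  Sat (t ≐ u) ρ = ⟦ t ⟧ ρ M.≈ ⟦ u ⟧ ρ
  Sat (t ⊑ u) ρ = ⟦ t ⟧ ρ M.⊑ ⟦ u ⟧ ρ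
  Sat ⊥̇       ρ = ⊥
  Sat (φ ∧ ψ) ρ = Sat φ ρ × Sat ψ ρ
  Sat (φ ∨ ψ) ρ = Sat φ ρ ⊎ Sat ψ ρ
  Sat (φ ⇒ ψ) ρ = Sat φ ρ → Sat ψ ρ
  Sat (∀̇ φ)   ρ = ∀ x → Sat φ (x ∷ ρ)
  Sat (∃̇ φ)   ρ = ∃ λ x → Sat φ (x ∷ ρ)

infix 4 _⊨_ _≡ₑ_

_⊨_ : ∀ {n} → Structure n ℓ → Sentence n → Set ℓ
M ⊨ φ = Sat M φ []

_≡ₑ_ : ∀ {n} → Structure n a → Structure n b → Set (a ⊔ b)
M ≡ₑ N = ∀ φ → (M ⊨ φ) ⇔ (N ⊨ φ)

module _ (n : ℕ) (α : Ordinal ℓ) where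
  open Ordinal α

  -- The function's value must not depend on the proof of γ < length,
  -- hence the irrelevant argument.
  record Sequence : Set ℓ where
    constructor _,_
    field
      length : Carrier
      entry  : ∀ γ → .(γ < length) → Fin n

module _ {n : ℕ} {α : Ordinal ℓ} where
  open Ordinal α

  infix 4 ⟨_,_⟩∈_ _⊆_ _≋_

  ⟨_,_⟩∈_ : Carrier → Fin n → Sequence n α → Set ℓ
  ⟨ γ , i ⟩∈ (β , f) = Σ (γ < β) λ γ<β → f γ γ<β ≡ i

  _⊆_ : Rel (Sequence n α) ℓ
  s ⊆ t = ∀ {γ i} → ⟨ γ , i ⟩∈ s → ⟨ γ , i ⟩∈ t

  -- Equality of functions as sets of pairs.
  _≋_ : Rel (Sequence n α) ℓ
  s ≋ t = s ⊆ t × t ⊆ s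

  -- γ < β + 1 and γ ≮ β mean γ = β, where the new entry i sits.
  extend : Fin n → (s : Sequence n α) → Carrier → Fin n
  extend i (β , f) γ with γ <? β
  ... | yes γ<β = f γ γ<β
  ... | no  _   = i

  append : IsNonzeroLimit α → Fin n → Sequence n α → Sequence n α
  append lim i s = Sequence.length s ⁺ , λ γ _ → extend i s γ
    where open IsNonzeroLimit lim

  ⊆⇒<-length : ∀ {s t : Sequence n α} → s ⊆ t → ∀ {γ} →
              γ < Sequence.length s → γ < Sequence.length t
  ⊆⇒<-length s⊆t γ<s = proj₁ (s⊆t (γ<s , refl))

  ≋⇒length≡ : ∀ {s t : Sequence n α} → s ≋ t → Sequence.length s ≡ Sequence.length t
  ≋⇒length≡ {s} {t} (s⊆t , t⊆s) with compare (Sequence.length s) (Sequence.length t)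
  ... | tri< s<t _ _ = contradiction (⊆⇒<-length {t} {s} t⊆s s<t) (irrefl refl)
  ... | tri≈ _ s≡t _ = s≡t
  ... | tri> _ _ t<s = contradiction (⊆⇒<-length {s} {t} s⊆t t<s) (irrefl refl)

  extend-⊆ : ∀ i {s t : Sequence n α} → Sequence.length s ≡ Sequence.length t →
             s ⊆ t → ∀ γ → extend i t γ ≡ extend i s γ
  extend-⊆ i {β , f} {.β , g} refl s⊆t γ with γ <? β
  ... | yes γ<β = proj₂ (s⊆t (γ<β , refl))
  ... | no  _   = refl

  append-⊆ : ∀ lim i {s t : Sequence n α} → Sequence.length s ≡ Sequence.length t →
             s ⊆ t → append lim i s ⊆ append lim i t
  append-⊆ lim i {β , f} {.β , g} refl s⊆t {γ} (γ<β⁺ , e) =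
    γ<β⁺ , trans (extend-⊆ i {β , f} {β , g} refl s⊆t γ) e

  append-cong : ∀ lim i {s t : Sequence n α} → s ≋ t → append lim i s ≋ append lim i t
  append-cong lim i {s} {t} s≋t@(s⊆t , t⊆s) =
    append-⊆ lim i {s} {t} len s⊆t , append-⊆ lim i {t} {s} (sym len) t⊆s
    where len = ≋⇒length≡ {s} {t} s≋t

𝔗 : ∀ n (α : Ordinal ℓ) → IsNonzeroLimit α → Structure n ℓ
𝔗 n α lim = record
  { Carrier       = Sequence n α
  ; _≈_           = _≋_
  ; _⊑_           = _⊆_
  ; S             = append lim
  ; ≈-equivalence = record
    { refl  = (λ p → p) , (λ p → p)
    ; sym   = λ (p , q) → q , p
    ; trans = λ (p , q) (p′ , q′) → (λ x → p′ (p x)) , (λ x → q (q′ x))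
    }
  ; ⊑-resp-≈      = (λ (p , _) s⊆t x → p (s⊆t x)) , (λ (_ , q) s⊆t x → s⊆t (q x))
  ; S-cong        = λ i {s} {t} → append-cong lim i {s} {t}
  }

{-# OPTIONS --safe #-}
module Submission where

-- The ordinal e < ω^ω is definable in every 𝔗 n α, uniformly in α, as the
-- length of a node: quantifiers over the initial segments of a node are
-- quantifiers over the ordinals up to its length, and "y = x + ω^(k+1)" says
-- that y is the least point above x that is closed under adding ω^k to the
-- points between x and y.  Hence θ < ω^ω is determined by the theory of 𝔗 n θ:
-- it is the least ordinal e such that no node has length e.

open import Defs
open import Axiom.ExcludedMiddle using (ExcludedMiddle)
open import Data.Empty.Polymorphic using () renaming (⊥ to ⊥ₚ)
open import Data.Fin using (Fin; zero; suc)
open import Data.Nat as ℕ using (ℕ; zero; suc; _≤_; s≤s)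
import Data.Nat.Properties as ℕ
open import Data.Product using (∃; _×_; _,_; proj₁; proj₂)
open import Data.Product.Function.NonDependent.Propositional using (_×-⇔_)
open import Data.Sum using (inj₁; inj₂)
open import Data.Sum.Function.Propositional using (_⊎-⇔_)
open import Data.Unit using (tt)
open import Data.Vec using (Vec; []; _∷_; lookup)
open import Data.Vec.Relation.Binary.Pointwise.Inductive as Pointwise
  using (Pointwise; []; _∷_)
open import Function.Base using (id; _∘_)
open import Function.Bundles using (_⇔_; mk⇔; module Equivalence)
open import Induction.WellFounded using (Acc; acc; module All)
open import Level using (Level; _⊔_; lift; lower)
open import Relation.Binary using (Rel; tri<; tri≈; tri>)
open import Relation.Binary.Morphism.Structures using (IsOrderIsomorphism; IsOrderMonomorphism)
open import Relation.Binary.PropositionalEquality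
  using (_≡_; refl; sym; trans; cong; subst)
open import Relation.Nullary using (¬_; Dec; yes; no; contradiction)

open Equivalence using (to; from)

private
  variable
    a b c ℓ : Level
    n j : ℕ

-- Addition of powers of ω

module Addition (Ω : Ordinal b) where
  open Ordinal Ω

  mutual
    -- Only the order occurs, and every quantifier is bounded by `y`, so the definition can be
    -- copied as a first-order formula about the initial segments of one node. The condition
    -- `¬ z < x` expresses `x ≤ z`.
    Closed : ℕ → Rel Carrier b
    Closed zero    x y = x < y
    Closed (suc k) x y =
      x < y × (∀ z → z < y → ¬ z < x → ∃ λ w → w < y × Step k z w)

    -- Step k x y means y = x + ω^k.
    Step : ℕ → Rel Carrier b
    Step k x y = Closed k x y × (∀ y′ → y′ < y → ¬ Closed k x y′)

  Bottom : Carrier → Set b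
  Bottom y = ∀ z → ¬ z < y

  -- y = x + ω^k · m for some x satisfying Q
  Multiple : ℕ → ℕ → (Carrier → Set b) → Carrier → Set b
  Multiple k zero    Q y = Q y
  Multiple k (suc m) Q y = ∃ λ z → z < y × Multiple k m Q z × Step k z y

  -- y = x + e for some x satisfying Q
  Offset : ∀ k → Ordinal.Carrier (ω^ k) → (Carrier → Set b) → Carrier → Set b
  Offset zero    _       Q = Q
  Offset (suc k) (m , e) Q = Offset k e (Multiple k m Q)

  asym : ∀ {x y} → x < y → ¬ y < x
  asym x<y y<x = irrefl refl (<-trans x<y y<x)

  Unique : (Carrier → Set b) → Set b
  Unique Q = ∀ {y y′} → Q y → Q y′ → y ≡ y′

  closed⇒< : ∀ k {x y} → Closed k x y → x < y
  closed⇒< zero    x<y       = x<y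
  closed⇒< (suc k) (x<y , _) = x<y

  step-unique : ∀ k {x} → Unique (Step k x)
  step-unique k {x} {y} {y′} (p , min) (p′ , min′) with compare y y′
  ... | tri< y<y′ _ _ = contradiction p (min′ y y<y′)
  ... | tri≈ _ y≡y′ _ = y≡y′
  ... | tri> _ _ y′<y = contradiction p′ (min y′ y′<y)

  bottom-unique : Unique Bottom
  bottom-unique {y} {y′} p p′ with compare y y′
  ... | tri< y<y′ _ _ = contradiction y<y′ (p′ y)
  ... | tri≈ _ y≡y′ _ = y≡y′
  ... | tri> _ _ y′<y = contradiction y′<y (p y′)

  multiple-unique : ∀ k m {Q} → Unique Q → Unique (Multiple k m Q)
  multiple-unique k zero    u p p′ = u p p′
  multiple-unique k (suc m) u (z , _ , p , s) (z′ , _ , p′ , s′)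
    with refl ← multiple-unique k m u p p′ = step-unique k s s′

  offset-unique : ∀ k e {Q} → Unique Q → Unique (Offset k e Q)
  offset-unique zero    _       u = u
  offset-unique (suc k) (m , e) u = offset-unique k e (multiple-unique k m u)

-- Intervals isomorphic to a power of ω

0ω : ∀ k → Ordinal.Carrier (ω^ k)
0ω zero    = tt
0ω (suc k) = 0 , 0ω k

≮0ω : ∀ k e → ¬ Ordinal._<_ (ω^ k) e (0ω k)
≮0ω zero    _       ()
≮0ω (suc k) (m , e) (inj₂ (_ , e<0)) = ≮0ω k e e<0

module _ (α : Ordinal a) (Ω : Ordinal b) where
  private
    module A = Ordinal α
    module Ω = Ordinal Ω

  -- Convexity, rather than being an initial segment, is what survives restriction to a single copy
  -- of `ω^ k` inside `ω^ suc k`. The induction on `k` works inside such copies.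
  record IsConvexEmbedding (f : A.Carrier → Ω.Carrier) : Set (a ⊔ b) where
    field
      mono   : ∀ {x y} → x A.< y → f x Ω.< f y
      convex : ∀ x y {z} → ¬ z Ω.< f x → z Ω.< f y → ∃ λ w → z ≡ f w

    cancel : ∀ {x y} → f x Ω.< f y → x A.< y
    cancel {x} {y} fx<fy with A.compare x y
    ... | tri< x<y _ _  = x<y
    ... | tri≈ _ refl _ = contradiction fx<fy (Ω.irrefl refl)
    ... | tri> _ _ y<x  = contradiction (mono y<x) (Addition.asym Ω fx<fy)

id-convex : (Ω : Ordinal b) → IsConvexEmbedding Ω Ω id
id-convex Ω = record { mono = id ; convex = λ _ _ {z} _ _ → z , refl }

module _ {Ω : Ordinal b} where
  open Ordinal Ω
  open Addition Ω

  module _ k {f : Ordinal.Carrier (ω^ suc k) → Carrier}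
           (f-convex : IsConvexEmbedding (ω^ suc k) Ω f) where
    open IsConvexEmbedding f-convex

    -- By convexity `z` is in the image. Its copy index is at most `m`, since nothing precedes
    -- `0ω k` in copy `suc m`, and at least `m`, since `z` is not below a point of copy `m`.
    column : ∀ m e {z} → ¬ z < f (m , e) → z < f (suc m , 0ω k) → ∃ λ e′ → z ≡ f (m , e′)
    column m e z≮ z< with convex _ _ z≮ z<
    ... | (i , e′) , refl with cancel z< | ℕ.<-cmp i m
    ...   | inj₂ (_ , e′<0)      | _               = contradiction e′<0 (≮0ω k e′)
    ...   | inj₁ _               | tri< i<m _ _    = contradiction (mono (inj₁ i<m)) z≮
    ...   | inj₁ _               | tri≈ _ refl _   = e′ , refl
    ...   | inj₁ (s≤s i≤m)       | tri> _ _ m<i    = contradiction i≤m (ℕ.<⇒≱ m<i)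

    slice-convex : ∀ m → IsConvexEmbedding (ω^ k) Ω (λ e → f (m , e))
    slice-convex m = record
      { mono   = λ x<y → mono (inj₂ (refl , x<y))
      ; convex = λ x y z≮ z< → column m x z≮ (<-trans z< (mono (inj₁ (ℕ.n<1+n m))))
      }

  mutual
    -- This is the absorption law e + ω^k = ω^k for e < ω^k: from any point of a copy of `ω^ k`,
    -- adding ω^k leads to the start of the next copy.
    step : ∀ k {f} → IsConvexEmbedding (ω^ suc k) Ω f →
           ∀ m e → Step k (f (m , e)) (f (suc m , 0ω k))
    step k f-convex m e = closed k f-convex m e , minimal k f-convex m e

    closed : ∀ k {f} → IsConvexEmbedding (ω^ suc k) Ω f →
             ∀ m e → Closed k (f (m , e)) (f (suc m , 0ω k))
    closed zero    f-convex m e = mono (inj₁ (ℕ.n<1+n m))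
      where open IsConvexEmbedding f-convex
    closed (suc k) {f} f-convex m e = mono (inj₁ (ℕ.n<1+n m)) , next
      where
      open IsConvexEmbedding f-convex
      next : ∀ z → z < f (suc m , 0ω (suc k)) → ¬ z < f (m , e) →
             ∃ λ w → w < f (suc m , 0ω (suc k)) × Step k z w
      next z z< z≮ with column (suc k) f-convex m e z≮ z<
      -- By `column`, `z` lies in subcopy `i` of copy `m`; the start of subcopy `suc i` is then z +
      -- ω^k and is still in copy `m`.
      ... | (i , d) , refl = f (m , suc i , 0ω k) , mono (inj₁ (ℕ.n<1+n m)) ,
                             step k (slice-convex (suc k) f-convex m) i d

    minimal : ∀ k {f} → IsConvexEmbedding (ω^ suc k) Ω f →
              ∀ m e y → y < f (suc m , 0ω k) → ¬ Closed k (f (m , e)) y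
    minimal k f-convex m e y y< h with column k f-convex m e (asym (closed⇒< k h)) y<
    -- A copy of ω^0 is a single point, so `y` would be `x` itself.
    minimal zero    f-convex m e _ y< h       | _ , refl = irrefl refl h
    minimal (suc k) {f} f-convex m (i , d) _ y< (x<y , h) | (l , d′) , refl = absurd
      where
      open IsConvexEmbedding f-convex

      -- Being closed, y exceeds x + ω^k · r for every r.
      climb : ∀ r → ∃ λ d → f (m , r ℕ.+ i , d) < f (m , l , d′) ×
                            ¬ f (m , r ℕ.+ i , d) < f (m , i , _)
      climb zero = d , x<y , irrefl refl
      climb (suc r) with climb r
      ... | d″ , z<y , z≮x with h _ z<y z≮x
      ...   | w , w<y , z+ω^k≡w
            -- Closure provides some `w` equal to z + ω^k; uniqueness identifies it with the start
            -- of the next subcopy.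
            with refl ← step-unique k z+ω^k≡w
                          (step k (slice-convex (suc k) f-convex m) (r ℕ.+ i) d″) =
            0ω k , w<y , λ w<x → z≮x (<-trans (closed⇒< k (proj₁ z+ω^k≡w)) w<x)

      absurd : _
      -- With r = l + 1 the climb reaches subcopy l + 1 + i, which cannot lie below a point of
      -- subcopy `l`.
      absurd with cancel (proj₁ (proj₂ (climb (suc l))))
      ... | inj₁ m<m                = ℕ.<-irrefl refl m<m
      ... | inj₂ (_ , inj₁ p)       = ℕ.m+n≮m (suc l) i (ℕ.<-trans p (ℕ.n<1+n l))
      ... | inj₂ (_ , inj₂ (p , _)) = ℕ.m+1+n≢m l (trans (ℕ.+-suc l i) p)

  multiple : ∀ k {f} → IsConvexEmbedding (ω^ suc k) Ω f →
             ∀ {Q} → Q (f (0ω (suc k))) → ∀ m → Multiple k m Q (f (m , 0ω k))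
  multiple k f-convex q zero    = q
  multiple k f-convex q (suc m) =
    _ , closed⇒< k (proj₁ s) , multiple k f-convex q m , s
    where s = step k f-convex m (0ω k)

  -- Induction along the Cantor normal form: the leading coefficient `m` leads to the start of the
  -- `m`-th copy of ω^k, and the remaining terms are added inside that copy.
  offset : ∀ k {f} → IsConvexEmbedding (ω^ k) Ω f →
           ∀ e {Q} → Q (f (0ω k)) → Offset k e Q (f e)
  offset zero    f-convex e       q = q
  offset (suc k) f-convex (m , e) q =
    offset k (slice-convex k f-convex m) e (multiple k f-convex q m)

Position : ∀ (Ω : Ordinal b) k → Ordinal.Carrier (ω^ k) → Ordinal.Carrier Ω → Set b
Position Ω k e = Offset k e Bottom
  where open Addition Ω

position-self : ∀ k e → Position (ω^ k) k e e
position-self k e = offset k (id-convex (ω^ k)) e (≮0ω k)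

position-unique : ∀ (Ω : Ordinal b) k e {y y′} →
                  Position Ω k e y → Position Ω k e y′ → y ≡ y′
position-unique Ω k e = offset-unique k e bottom-unique
  where open Addition Ω

-- Elements at which two well-orders have isomorphic initial segments

module Matching (α : Ordinal a) (β : Ordinal b) where
  private
    module A = Ordinal α
    module B = Ordinal β

  infix 4 _~_

  -- An inductive back-and-forth relation takes the place of an isomorphism between the two initial
  -- segments, so that each use unfolds a single step.
  data _~_ (x : A.Carrier) (y : B.Carrier) : Set (a ⊔ b) where
    match : (∀ x′ → x′ A.< x → ∃ λ y′ → y′ B.< y × x′ ~ y′) →
            (∀ y′ → y′ B.< y → ∃ λ x′ → x′ A.< x × x′ ~ y′) → x ~ y

  forth : ∀ {x x′ y} → x ~ y → x′ A.< x → ∃ λ y′ → y′ B.< y × x′ ~ y′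
  forth (match f _) = f _

  back : ∀ {x y y′} → x ~ y → y′ B.< y → ∃ λ x′ → x′ A.< x × x′ ~ y′
  back (match _ g) = g _

  -- Descent: going back from `y′` and then forth into `y` yields a point `x₁` matched both with `y`
  -- and with some `y₁ < y`, the same situation with a smaller first point.
  ~⇒≮ : ∀ {x y y′} → Acc B._<_ y → x ~ y → x ~ y′ → ¬ y B.< y′
  ~⇒≮ (acc rs) p p′ y<y′ with back p′ y<y′
  ... | x₁ , x₁<x , q′ with forth p x₁<x
  ...   | y₁ , y₁<y , q = ~⇒≮ (rs y₁<y) q q′ y₁<y

  ~-unique : ∀ {x y y′} → x ~ y → x ~ y′ → y ≡ y′
  ~-unique {y = y} {y′} p p′ with B.compare y y′
  ... | tri< y<y′ _ _ = contradiction y<y′ (~⇒≮ (B.wellFounded y) p p′)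
  ... | tri≈ _ y≡y′ _ = y≡y′
  ... | tri> _ _ y′<y = contradiction y′<y (~⇒≮ (B.wellFounded y′) p′ p)

  ~-mono : ∀ {x x′ y y′} → x ~ y → x′ ~ y′ → x A.< x′ → y B.< y′
  ~-mono p p′ x<x′ with forth p′ x<x′
  ... | z , z<y′ , q = subst (B._< _) (~-unique q p) z<y′

  ~-cancel : ∀ {x x′ y y′} → x ~ y → x′ ~ y′ → y B.< y′ → x A.< x′
  ~-cancel {x} {x′} {y} {y′} p p′ y<y′ with A.compare x x′
  ... | tri< x<x′ _ _ = x<x′
  ... | tri≈ _ refl _ = contradiction y<y′ (~⇒≮ (B.wellFounded y) p p′)
  ... | tri> _ _ x′<x = contradiction (~-mono p′ p x′<x) (Addition.asym β y<y′)

-- The defining formulas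

infix 8 _⊏_

_⊏_ : Fin j → Fin j → Formula n j
x ⊏ y = var x ⊑ var y ∧ (var y ⊑ var x ⇒ ⊥̇)

mutual
  closedF : ℕ → Fin j → Fin j → Formula n j
  closedF zero    x y = x ⊏ y
  closedF (suc k) x y =
    x ⊏ y ∧ ∀̇ (zero ⊏ suc y ⇒ (zero ⊏ suc x ⇒ ⊥̇) ⇒
                ∃̇ (zero ⊏ suc (suc y) ∧ stepF k (suc zero) zero))

  stepF : ℕ → Fin j → Fin j → Formula n j
  stepF k x y = closedF k x y ∧ ∀̇ (zero ⊏ suc y ⇒ closedF k (suc x) zero ⇒ ⊥̇)

bottomF : Fin j → Formula n j
bottomF y = ∀̇ (zero ⊏ suc y ⇒ ⊥̇)

-- `Q` is polymorphic in the number of variables because it ends up under further quantifiers. The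
-- guard `zero ⊏ suc y` keeps the witness below `y`, where a bisimulation can follow it.
multipleF : ℕ → ℕ → (∀ {j} → Fin j → Formula n j) → Fin j → Formula n j
multipleF k zero    Q y = Q y
multipleF k (suc m) Q y =
  ∃̇ (zero ⊏ suc y ∧ multipleF k m Q zero ∧ stepF k zero (suc y))

offsetF : ∀ k → Ordinal.Carrier (ω^ k) → (∀ {j} → Fin j → Formula n j) →
          Fin j → Formula n j
offsetF zero    _       Q = Q
offsetF (suc k) (m , e) Q = offsetF k e (multipleF k m Q)

∃positionF : ∀ k → Ordinal.Carrier (ω^ k) → Sentence n
∃positionF k e = ∃̇ (offsetF k e bottomF zero)

-- Transfer of the defining formulas along a bisimulation

module _ (M : Structure n a) (Ω : Ordinal b) where
  private
    module M = Structure M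
    module Ω = Ordinal Ω

  _⊂_ : Rel M.Carrier a
  s ⊂ t = s M.⊑ t × (t M.⊑ s → ⊥ₚ {a})

  -- The quantifiers inside the defining formulas are all bounded by `⊏`, so `E` has to supply
  -- partners only below elements that already have one.
  record IsBisimulation (E : M.Carrier → Ω.Carrier → Set c) : Set (a ⊔ b ⊔ c) where
    field
      mono   : ∀ {s t x y} → E s x → E t y → s ⊂ t → x Ω.< y
      cancel : ∀ {s t x y} → E s x → E t y → x Ω.< y → s ⊂ t
      forth  : ∀ {s t y} → E t y → s ⊂ t → ∃ (E s)
      back   : ∀ {t x y} → E t y → x Ω.< y → ∃ λ s → E s x

module _ {M : Structure n a} {Ω : Ordinal b}
         {E : Structure.Carrier M → Ordinal.Carrier Ω → Set c}
         (E-bisim : IsBisimulation M Ω E) where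
  open IsBisimulation E-bisim
  open Addition Ω
  private module M = Structure M

  mutual
    closed→ : ∀ k {ρ : Vec M.Carrier j} {u v x y} → E (lookup ρ u) x → E (lookup ρ v) y →
              Sat M (closedF k u v) ρ → Closed k x y
    closed→ zero    p q h       = mono p q h
    closed→ (suc k) p q (h , r) = mono p q h , λ z z<y z≮x →
      let s , s~z     = back q z<y
          t , t⊂v , σ = r s (cancel s~z q z<y) (λ s⊂u → lift (z≮x (mono s~z p s⊂u)))
          w , t~w     = forth q t⊂v
      in w , mono t~w q t⊂v , step→ k {u = suc zero} {v = zero} s~z t~w σ

    closed← : ∀ k {ρ : Vec M.Carrier j} {u v x y} → E (lookup ρ u) x → E (lookup ρ v) y →
              Closed k x y → Sat M (closedF k u v) ρ
    closed← zero    p q h       = cancel p q h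
    closed← (suc k) p q (h , r) = cancel p q h , λ s s⊂v s⊄u →
      let z , s~z     = forth q s⊂v
          w , w<y , σ = r z (mono s~z q s⊂v) (λ z<x → lower (s⊄u (cancel s~z p z<x)))
          t , t~w     = back q w<y
      in t , cancel t~w q w<y , step← k {u = suc zero} {v = zero} s~z t~w σ

    step→ : ∀ k {ρ : Vec M.Carrier j} {u v x y} → E (lookup ρ u) x → E (lookup ρ v) y →
            Sat M (stepF k u v) ρ → Step k x y
    step→ k {u = u} {v} p q (h , r) = closed→ k {u = u} {v} p q h , λ y′ y′<y h′ →
      let s , s~y′ = back q y′<y
      -- Minimality denies closedness below `y`, so this direction relies on the converse direction
      -- for `Closed`.
      in lower (r s (cancel s~y′ q y′<y) (closed← k {u = suc u} {v = zero} p s~y′ h′))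

    step← : ∀ k {ρ : Vec M.Carrier j} {u v x y} → E (lookup ρ u) x → E (lookup ρ v) y →
            Step k x y → Sat M (stepF k u v) ρ
    step← k {u = u} {v} p q (h , r) = closed← k {u = u} {v} p q h , λ s s⊂v h′ →
      let y′ , s~y′ = forth q s⊂v
      in lift (r y′ (mono s~y′ q s⊂v) (closed→ k {u = suc u} {v = zero} p s~y′ h′))

  Transfers : (∀ {j} → Fin j → Formula n j) → (Ordinal.Carrier Ω → Set b) → Set _
  Transfers F Q = ∀ {j} {ρ : Vec M.Carrier j} v {y} → E (lookup ρ v) y → Sat M (F v) ρ ⇔ Q y

  bottom-transfers : Transfers bottomF Bottom
  bottom-transfers v q = mk⇔
    (λ h z z<y → let s , s~z = back q z<y in lower (h s (cancel s~z q z<y)))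
    (λ h s s⊂v → let z , s~z = forth q s⊂v in lift (h z (mono s~z q s⊂v)))

  multiple-transfers : ∀ k m {F : ∀ {j} → Fin j → Formula n j} {Q} →
                       Transfers F Q → Transfers (multipleF k m F) (Multiple k m Q)
  multiple-transfers k zero    F⇔Q = F⇔Q
  multiple-transfers k (suc m) F⇔Q v q = mk⇔
    (λ (s , s⊂v , h , σ) →
      let z , s~z = forth q s⊂v
      in z , mono s~z q s⊂v , to (multiple-transfers k m F⇔Q zero s~z) h ,
         step→ k {u = zero} {v = suc v} s~z q σ)
    (λ (z , z<y , h , σ) →
      let s , s~z = back q z<y
      in s , cancel s~z q z<y , from (multiple-transfers k m F⇔Q zero s~z) h ,
         step← k {u = zero} {v = suc v} s~z q σ)

  offset-transfers : ∀ k e {F : ∀ {j} → Fin j → Formula n j} {Q} →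
                     Transfers F Q → Transfers (offsetF k e F) (Offset k e Q)
  offset-transfers zero    _       F⇔Q = F⇔Q
  offset-transfers (suc k) (m , e) F⇔Q = offset-transfers k e (multiple-transfers k m F⇔Q)

-- Initial segments of a node

module _ {α : Ordinal ℓ} where
  open Ordinal α
  open Addition α using (asym)

  restrict : ∀ (s : Sequence n α) γ → γ < Sequence.length s → Sequence n α
  restrict (β , f) γ γ<β = γ , λ δ δ<γ → f δ (<-trans δ<γ γ<β)

  restrict-⊆ : ∀ (s : Sequence n α) γ γ<s → restrict s γ γ<s ⊆ s
  restrict-⊆ s γ γ<s (δ<γ , e) = <-trans δ<γ γ<s , e

  ⊆-value : ∀ {s t : Sequence n α} {γ} .(γ<s : γ < Sequence.length s)
            .(γ<t : γ < Sequence.length t) → s ⊆ t → γ < Sequence.length s →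
            Sequence.entry t γ γ<t ≡ Sequence.entry s γ γ<s
  ⊆-value _ _ s⊆t γ<s = proj₂ (s⊆t (γ<s , refl))

  ⊂⇒<-length : ∀ {s t : Sequence n α} → s ⊆ t → ¬ t ⊆ s →
               Sequence.length s < Sequence.length t
  ⊂⇒<-length {s = s@(β , f)} {t@(γ , g)} s⊆t t⊈s with compare β γ
  ... | tri< β<γ _ _  = β<γ
  ... | tri≈ _ refl _ = contradiction
    (λ { (δ<β , refl) → δ<β , sym (⊆-value {s = s} {t} δ<β δ<β s⊆t δ<β) }) t⊈s
  ... | tri> _ _ γ<β  = contradiction (⊆⇒<-length {s = s} {t} s⊆t γ<β) (irrefl refl)

  -- Both sequences take their values from the common extension `r`, so they agree wherever both are
  -- defined and only their lengths matter.
  ⊆-<-length⇒⊆ : ∀ {r s t : Sequence n α} → s ⊆ r → t ⊆ r →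
                 Sequence.length s < Sequence.length t → s ⊆ t
  ⊆-<-length⇒⊆ {r = r} {s} {t} s⊆r t⊆r s<t {γ} (γ<s , refl) = γ<t ,
    trans (sym (⊆-value {s = t} {r} γ<t γ<r t⊆r γ<t)) (⊆-value {s = s} {r} γ<s γ<r s⊆r γ<s)
    where
    γ<t = <-trans γ<s s<t
    γ<r = ⊆⇒<-length {s = s} {r} s⊆r γ<s

module _ (β : Ordinal ℓ) (lim : IsNonzeroLimit β) (Ω : Ordinal b) where
  private
    module B = Ordinal β
    module ~ = Matching β Ω
  open Matching β Ω using (_~_)

  -- Fixing `r` cuts the tree down to a chain: among the initial segments of one node, inclusion is
  -- comparison of lengths. For incomparable nodes `cancel` could fail.
  prefix-bisim : (r : Sequence n β) →
    IsBisimulation (𝔗 n β lim) Ω (λ s x → s ⊆ r × Sequence.length s ~ x)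
  prefix-bisim r = record
    { mono   = λ {s} {t} (_ , p) (_ , q) (s⊆t , t⊈s) →
        ~.~-mono p q (⊂⇒<-length {s = s} {t} s⊆t (λ t⊆s → lower (t⊈s t⊆s)))
    ; cancel = λ {s} {t} (s⊆r , p) (t⊆r , q) x<y →
        let s<t = ~.~-cancel p q x<y
        in (λ {_} {_} → ⊆-<-length⇒⊆ {r = r} {s} {t} s⊆r t⊆r s<t) ,
           λ t⊆s → contradiction (⊆⇒<-length {s = t} {s} t⊆s s<t) (B.irrefl refl)
    ; forth  = λ {s} {t} (t⊆r , q) (s⊆t , t⊈s) →
        let x , _ , p = ~.forth q (⊂⇒<-length {s = s} {t} s⊆t (λ t⊆s → lower (t⊈s t⊆s)))
        in x , (λ {_} {_} h → t⊆r (s⊆t h)) , p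
    ; back   = λ {t} (t⊆r , q) x<y →
        let γ , γ<t , p = ~.back q x<y
        in restrict t γ γ<t , (λ {_} {_} h → t⊆r (restrict-⊆ t γ γ<t h)) , p
    }

  position⇔ : ∀ k e (r : Sequence n β) {x} → Sequence.length r ~ x →
              Sat (𝔗 n β lim) (offsetF k e bottomF zero) (r ∷ []) ⇔ Position Ω k e x
  position⇔ k e r p =
    offset-transfers bisim k e {bottomF} (λ {_} {ρ} → bottom-transfers bisim {ρ = ρ})
      zero ((λ {_} {_} h → h) , p)
    where bisim = prefix-bisim r

-- Isomorphic structures

module _ (M : Structure n a) (N : Structure n b) where
  private
    module M = Structure M
    module N = Structure N

  -- A relation total on both sides is enough for the quantifier cases, and since `=` is read as
  -- `_≈_`, partners need to be determined only up to `_≈_`.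
  record IsIsomorphism (R : M.Carrier → N.Carrier → Set c) : Set (a ⊔ b ⊔ c) where
    field
      ≈⇔      : ∀ {s s′ t t′} → R s t → R s′ t′ → (s M.≈ s′) ⇔ (t N.≈ t′)
      ⊑⇔      : ∀ {s s′ t t′} → R s t → R s′ t′ → (s M.⊑ s′) ⇔ (t N.⊑ t′)
      S-homo  : ∀ i {s t} → R s t → R (M.S i s) (N.S i t)
      total   : ∀ s → ∃ (R s)
      totalˡ  : ∀ t → ∃ λ s → R s t

module _ {M : Structure n a} {N : Structure n b}
         {R : Structure.Carrier M → Structure.Carrier N → Set c}
         (R-iso : IsIsomorphism M N R) where
  open IsIsomorphism R-iso

  ⟦⟧-iso : ∀ (t : Term n j) {ρ σ} → Pointwise R ρ σ → R (⟦_⟧ M t ρ) (⟦_⟧ N t σ)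
  ⟦⟧-iso (var x) rs = Pointwise.lookup rs x
  ⟦⟧-iso (S i t) rs = S-homo i (⟦⟧-iso t rs)

  Sat-iso : ∀ (φ : Formula n j) {ρ σ} → Pointwise R ρ σ → Sat M φ ρ ⇔ Sat N φ σ
  Sat-iso (t ≐ u) rs = ≈⇔ (⟦⟧-iso t rs) (⟦⟧-iso u rs)
  Sat-iso (t ⊑ u) rs = ⊑⇔ (⟦⟧-iso t rs) (⟦⟧-iso u rs)
  Sat-iso ⊥̇       rs = mk⇔ (λ ()) (λ ())
  Sat-iso (φ ∧ ψ) rs = Sat-iso φ rs ×-⇔ Sat-iso ψ rs
  Sat-iso (φ ∨ ψ) rs = Sat-iso φ rs ⊎-⇔ Sat-iso ψ rs
  Sat-iso (φ ⇒ ψ) rs = mk⇔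
    (λ h → to (Sat-iso ψ rs) ∘ h ∘ from (Sat-iso φ rs))
    (λ h → from (Sat-iso ψ rs) ∘ h ∘ to (Sat-iso φ rs))
  Sat-iso (∀̇ φ)   rs = mk⇔
    (λ h t → let s , r = totalˡ t in to (Sat-iso φ (r ∷ rs)) (h s))
    (λ h s → let t , r = total s in from (Sat-iso φ (r ∷ rs)) (h t))
  Sat-iso (∃̇ φ)   rs = mk⇔
    (λ (s , h) → let t , r = total s in t , to (Sat-iso φ (r ∷ rs)) h)
    (λ (t , h) → let s , r = totalˡ t in s , from (Sat-iso φ (r ∷ rs)) h)

  iso⇒≡ₑ : M ≡ₑ N
  iso⇒≡ₑ φ = Sat-iso φ []

-- Trees over isomorphic ordinals

module _ (α : Ordinal a) (β : Ordinal b) (iso : α ≅ β) where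
  private
    module A = Ordinal α
    module B = Ordinal β
    f = proj₁ iso
    module f = IsOrderIsomorphism (proj₂ iso)

    surjective : ∀ y → ∃ λ x → f x ≡ y
    surjective y = let x , h = f.surjective y in x , h refl

  Corresponds : Sequence n α → Sequence n β → Set (a ⊔ b)
  Corresponds (γ , s) (δ , t) =
    f γ ≡ δ × (∀ ε (p : ε A.< γ) (q : f ε B.< δ) → s ε p ≡ t (f ε) q)

  ∈⇔ : ∀ {s : Sequence n α} {t} → Corresponds s t →
       ∀ {γ i} → (⟨ γ , i ⟩∈ s) ⇔ (⟨ f γ , i ⟩∈ t)
  ∈⇔ {s = γ , s} {.(f γ) , t} (refl , h) = mk⇔
    (λ (p , e) → f.mono p , trans (sym (h _ p (f.mono p))) e)
    (λ (q , e) → f.cancel q , trans (h _ (f.cancel q) q) e)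

  ⊆⇔ : ∀ {s s′ : Sequence n α} {t t′} → Corresponds s t → Corresponds s′ t′ →
       (s ⊆ s′) ⇔ (t ⊆ t′)
  ⊆⇔ {s = s} {s′} {t} {t′} r r′ = mk⇔ forwards backwards
    where
    forwards : s ⊆ s′ → t ⊆ t′
    forwards s⊆s′ {δ} δ∈t with γ , refl ← surjective δ =
      to (∈⇔ {s = s′} {t′} r′) (s⊆s′ (from (∈⇔ {s = s} {t} r) δ∈t))

    backwards : t ⊆ t′ → s ⊆ s′
    backwards t⊆t′ γ∈s = from (∈⇔ {s = s′} {t′} r′) (t⊆t′ (to (∈⇔ {s = s} {t} r) γ∈s))

  module _ (α-lim : IsNonzeroLimit α) (β-lim : IsNonzeroLimit β) where
    private
      module α-lim = IsNonzeroLimit α-lim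
      module β-lim = IsNonzeroLimit β-lim

    -- Each side is the least element above `f γ`: if either were smaller, it would lie strictly
    -- above `f γ` and yet not above it.
    f-⁺ : ∀ γ → f (γ α-lim.⁺) ≡ (f γ) β-lim.⁺
    f-⁺ γ with B.compare (f (γ α-lim.⁺)) ((f γ) β-lim.⁺)
    ... | tri≈ _ e _ = e
    ... | tri< f⟨γ⁺⟩< _ _ with to (β-lim.<⁺ (f γ)) f⟨γ⁺⟩<
    ...   | inj₁ p = contradiction (B.<-trans p (f.mono (from (α-lim.<⁺ γ) (inj₂ refl)))) (B.irrefl refl)
    ...   | inj₂ e = contradiction (f.mono (from (α-lim.<⁺ γ) (inj₂ refl))) (B.irrefl (sym e))
    f-⁺ γ | tri> _ _ <f⟨γ⁺⟩ with surjective ((f γ) β-lim.⁺)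
    ...   | δ , e with to (α-lim.<⁺ γ) (f.cancel (subst (B._< _) (sym e) <f⟨γ⁺⟩))
    ...     | inj₁ δ<γ  = contradiction
      (B.<-trans (subst (B._< _) e (f.mono δ<γ)) (from (β-lim.<⁺ (f γ)) (inj₂ refl))) (B.irrefl refl)
    ...     | inj₂ refl = contradiction (from (β-lim.<⁺ (f γ)) (inj₂ refl)) (B.irrefl e)

    append-corresponds : ∀ i {s : Sequence n α} {t} → Corresponds s t →
                         Corresponds (append α-lim i s) (append β-lim i t)
    append-corresponds i {γ , s} {.(f γ) , t} (refl , h) = f-⁺ γ , λ ε _ _ → extend≡ ε
      where
      extend≡ : ∀ ε → extend {α = α} i (γ , s) ε ≡ extend {α = β} i (f γ , t) (f ε)
      extend≡ ε with ε A.<? γ | f ε B.<? f γ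
      ... | yes p | yes q = h ε p q
      ... | no  _ | no  _ = refl
      ... | yes p | no ¬q = contradiction (f.mono p) ¬q
      ... | no ¬p | yes q = contradiction (f.cancel q) ¬p

    𝔗-iso : IsIsomorphism (𝔗 n α α-lim) (𝔗 n β β-lim) Corresponds
    𝔗-iso = record
      { ≈⇔     = λ {s} {s′} {t} {t′} r r′ →
          ⊆⇔ {s = s} {s′} {t} {t′} r r′ ×-⇔ ⊆⇔ {s = s′} {s} {t′} {t} r′ r
      ; ⊑⇔     = λ {s} {s′} {t} {t′} → ⊆⇔ {s = s} {s′} {t} {t′}
      ; S-homo = λ i {s} {t} → append-corresponds i {s} {t}
      ; total  = λ (γ , s) →
          (f γ , λ δ δ<fγ → s (f⁻¹ δ) (f⁻¹-< δ δ<fγ)) ,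
          refl , λ ε p q → entry-cong s (sym (f.injective (proj₂ (surjective (f ε))))) p (f⁻¹-< (f ε) q)
      ; totalˡ = λ (δ , t) →
          (f⁻¹ δ , λ ε p → t (f ε) (subst (f ε B.<_) (proj₂ (surjective δ)) (f.mono p))) ,
          proj₂ (surjective δ) , λ _ _ _ → refl
      }
      where
      f⁻¹ : B.Carrier → A.Carrier
      f⁻¹ δ = proj₁ (surjective δ)

      f⁻¹-< : ∀ δ {γ} → δ B.< f γ → f⁻¹ δ A.< γ
      f⁻¹-< δ δ<fγ = f.cancel (subst (B._< _) (sym (proj₂ (surjective δ))) δ<fγ)

      -- Used because `f⁻¹ (f ε)` equals `ε` only propositionally; the bounds may differ freely,
      -- being irrelevant arguments.
      entry-cong : ∀ {γ ε ε′} (s : ∀ ε → .(ε A.< γ) → Fin n) → ε ≡ ε′ →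
                   .(p : ε A.< γ) .(p′ : ε′ A.< γ) → s ε p ≡ s ε′ p′
      entry-cong s refl _ _ = refl

-- Recovering θ from the theory of 𝔗 n θ

module _ (em : ExcludedMiddle ℓ) (i : Fin n)
         (θ : Ordinal ℓ) (θ-limit : IsNonzeroLimit θ) (θ<ω^ω : θ <ω^ω)
         (α : Ordinal ℓ) (α-limit : IsNonzeroLimit α)
         (α≡ₑθ : 𝔗 n α α-limit ≡ₑ 𝔗 n θ θ-limit) where
  private
    k = proj₁ θ<ω^ω
    f = proj₁ (proj₂ θ<ω^ω)
    module f = IsOrderMonomorphism (proj₁ (proj₂ (proj₂ θ<ω^ω)))
    d = proj₁ (proj₂ (proj₂ (proj₂ θ<ω^ω)))
    <d⇔ = proj₂ (proj₂ (proj₂ (proj₂ θ<ω^ω)))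

    Ω = ω^ k
    module A = Ordinal α
    module Θ = Ordinal θ
    module Ω = Ordinal Ω
    module α~ = Matching α Ω
    module θ~ = Matching θ Ω

    f<d : ∀ x → f x Ω.< d
    f<d x = from (<d⇔ (f x)) (x , refl)

    -- Since the image of `f` is exactly the set of points below `d`, every point below `f x` has a
    -- preimage, and well-founded induction matches it.
    θ~f : ∀ x → x θ~.~ f x
    θ~f = All.wfRec Θ.wellFounded _ (λ x → x θ~.~ f x) λ x rec → θ~.match
      (λ x′ x′<x → f x′ , f.mono x′<x , rec x′<x)
      (preimage x rec)
      where
      preimage : ∀ x → (∀ {x′} → x′ Θ.< x → x′ θ~.~ f x′) →
                 ∀ e → e Ω.< f x → ∃ λ x′ → x′ Θ.< x × x′ θ~.~ e
      preimage x rec e e<fx with to (<d⇔ e) (Ω.<-trans e<fx (f<d x))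
      ... | x′ , refl = x′ , f.cancel e<fx , rec (f.cancel e<fx)

    has-length : ∀ (β : Ordinal ℓ) (lim : IsNonzeroLimit β) {x e} →
                 Matching._~_ β Ω x e → 𝔗 n β lim ⊨ ∃positionF k e
    has-length β lim {x} {e} x~e =
      (x , λ _ _ → i) , from (position⇔ β lim Ω k e (x , λ _ _ → i) x~e) (position-self k e)

    -- The formula is understood only at nodes whose length matches some point of `Ω`. Nothing
    -- guarantees this yet, so the conclusion is conditional on a match.
    length-of : ∀ (β : Ordinal ℓ) (lim : IsNonzeroLimit β) {e} → 𝔗 n β lim ⊨ ∃positionF k e →
                ∃ λ x → ∀ {e′} → Matching._~_ β Ω x e′ → e′ ≡ e
    length-of β lim {e} (r , h) = Sequence.length r , λ p →
      position-unique Ω k e (to (position⇔ β lim Ω k e r p) h) (position-self k e)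

    Matched : Ω.Carrier → Set ℓ
    Matched e = ∃ λ x → x α~.~ e

    MatchedBelow : Ω.Carrier → A.Carrier → Set ℓ
    MatchedBelow e x = ∃ λ e′ → e′ Ω.< e × x α~.~ e′

    -- Here `e` is the least unmatched point. If all `x′ < x` are matched below `e` but `x` is not,
    -- then the partners of the points below `e` all lie below `x`, so `x` itself would match `e`.
    exhausts : ∀ e → (∀ {e′} → e′ Ω.< e → Matched e′) → ¬ Matched e → ∀ x → MatchedBelow e x
    exhausts e below ¬e = All.wfRec A.wellFounded _ (MatchedBelow e) λ x rec → cases x rec em
      where
      cases : ∀ x → (∀ {x′} → x′ A.< x → MatchedBelow e x′) →
              Dec (MatchedBelow e x) → MatchedBelow e x
      cases x rec (yes p) = p
      cases x rec (no ¬p) = contradiction (x , α~.match (λ _ → rec) back) ¬e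
        where
        back : ∀ e′ → e′ Ω.< e → ∃ λ x′ → x′ A.< x × x′ α~.~ e′
        back e′ e′<e with below e′<e
        ... | x′ , p with A.compare x′ x
        ...   | tri< x′<x _ _ = x′ , x′<x , p
        ...   | tri≈ _ refl _ = contradiction (e′ , e′<e , p) ¬p
        ...   | tri> _ _ x<x′ with α~.forth p x<x′
        ...     | e″ , e″<e′ , q = contradiction (e″ , Ω.<-trans e″<e′ e′<e , q) ¬p

    matched : ∀ e → e Ω.< d → Matched e
    matched = All.wfRec Ω.wellFounded _ (λ e → e Ω.< d → Matched e) λ e rec e<d →
      cases e (λ e′<e → rec e′<e (Ω.<-trans e′<e e<d)) e<d em
      where
      cases : ∀ e → (∀ {e′} → e′ Ω.< e → Matched e′) → e Ω.< d → Dec (Matched e) → Matched e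
      cases e below e<d (yes p) = p
      cases e below e<d (no ¬e) with to (<d⇔ e) e<d
      ... | y , refl
        -- Elementary equivalence carries a node at position `e = f y` from θ to α. By `exhausts`
        -- its length matches some `e′ < e`, whereas its position forces `e′ ≡ e`.
        with length-of α α-limit
               (from (α≡ₑθ (∃positionF k (f y))) (has-length θ θ-limit (θ~f y)))
      ...   | x , only-e with exhausts e below ¬e x
      ...     | e′ , e′<e , p = contradiction e′<e (Ω.irrefl (only-e p))

    -- A match for `d` would give α, and hence θ, a node at position `d`; but the length `y` of that
    -- node in θ matches `f y`, which is below `d`.
    ¬matched-d : ¬ Matched d
    ¬matched-d (_ , p)
      with length-of θ θ-limit (to (α≡ₑθ (∃positionF k d)) (has-length α α-limit p))
    ... | y , only-d = Ω.irrefl (only-d (θ~f y)) (f<d y)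

    α~θ : ∀ x → ∃ λ y → x α~.~ f y
    α~θ x with exhausts d (λ {e} → matched e) ¬matched-d x
    ... | e , e<d , p with to (<d⇔ e) e<d
    ...   | y , refl = y , p

    g : A.Carrier → Θ.Carrier
    g x = proj₁ (α~θ x)

    ~g : ∀ x → x α~.~ f (g x)
    ~g x = proj₂ (α~θ x)

    g-mono : ∀ {x x′} → x A.< x′ → g x Θ.< g x′
    g-mono x<x′ = f.cancel (α~.~-mono (~g _) (~g _) x<x′)

    g-cancel : ∀ {x x′} → g x Θ.< g x′ → x A.< x′
    g-cancel gx<gx′ = α~.~-cancel (~g _) (~g _) (f.mono gx<gx′)

    g-injective : ∀ {x x′} → g x ≡ g x′ → x ≡ x′
    g-injective {x} {x′} e with A.compare x x′
    ... | tri< x<x′ _ _ = contradiction (g-mono x<x′) (Θ.irrefl e)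
    ... | tri≈ _ x≡x′ _ = x≡x′
    ... | tri> _ _ x′<x = contradiction (g-mono x′<x) (Θ.irrefl (sym e))

    g-surjective : ∀ y → ∃ λ x → ∀ {z} → z ≡ x → g z ≡ y
    g-surjective y with matched (f y) (f<d y)
    ... | x , p = x , λ { refl → f.injective (α~.~-unique (~g x) p) }

  ≡ₑ⇒≅ : α ≅ θ
  ≡ₑ⇒≅ = g , record
    { isOrderMonomorphism = record
      { isOrderHomomorphism = record { cong = cong g ; mono = g-mono }
      ; injective           = g-injective
      ; cancel              = g-cancel
      }
    ; surjective = g-surjective
    }

theorem19 : ∀ {ℓ : Level} → ExcludedMiddle ℓ →
    (n : ℕ) → 2 ≤ n →
    (θ : Ordinal ℓ) (θ-limit : IsNonzeroLimit θ) → θ <ω^ω →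
    (α : Ordinal ℓ) (α-limit : IsNonzeroLimit α) →
    (𝔗 n α α-limit ≡ₑ 𝔗 n θ θ-limit) ⇔ (α ≅ θ)
theorem19 em n (s≤s _) θ θ-limit θ<ω^ω α α-limit = mk⇔
  -- Matching on `s≤s` exposes `n` as a successor, so `zero` is a letter; the constant nodes are
  -- built from it.
  (≡ₑ⇒≅ em zero θ θ-limit θ<ω^ω α α-limit)
  (λ α≅θ → iso⇒≡ₑ (𝔗-iso α θ α≅θ α-limit θ-limit))
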